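{- Let $k=4$ and $r_1\ge r_2\ge r_3\ge r_4\ge 1$. If $(r_2-1)+(r_3-1)-(r_4-1)\le (r_1-1)< (r_2-1)+(r_3-1)+(r_4-1)$, then the arithmetic mean component competitive ratio for the 4-objective time series search problem is $$z_f^4=\frac18\left[\sqrt{4r_4+\{(r_1-1)-(r_2-1)-(r_3-1)\}^2}+(r_1+1)+(r_2+1)+(r_3+1)\right].$$
   Context: For an integer $k\ge 2$ and reals $0<m_i\le M_i$ ($1\le i\le k$), let $r_i=M_i/m_i$ be the fluctuation ratio of the price interval $[m_i,M_i]$ of the $i$th objective. It is assumed throughout that $r_1\ge\cdots\ge r_k\ge 1$. The arithmetic mean component competitive ratio of the $k$-objective time series search problem is the quantity $$z_f^k=\sup_{(x_1,\ldots,x_k)\in\mathcal{S}_f^k}\frac1k\left(\frac{M_1}{x_1}+\cdots+\frac{M_k}{x_k}\right),$$ where $$\mathcal{S}_f^k=\left\{(x_1,\ldots,x_k)\in[m_1,M_1]\times\cdots\times[m_k,M_k] : \frac1k\sum_{i=1}^k\frac{x_i}{m_i}=\frac1k\sum_{i=1}^k\frac{M_i}{x_i}\right\}.$$ -}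

module Defs where

open import Algebra.Bundles using (CommutativeRing)
open import Data.Fin.Base using (Fin)
open import Data.Nat.Base using (ℕ)
open import Data.Product.Base using (∃; _×_; _,_; proj₁; proj₂)
open import Data.Sum.Base using (_⊎_; inj₁; inj₂)
open import Data.Empty using (⊥-elim)
open import Data.Vec.Functional using (Vector)
open import Level using (Level; suc)
open import Relation.Binary.Bundles using (Poset)
open import Relation.Binary.Core using (Rel)
open import Relation.Binary.Structures using (IsDecTotalOrder)
open import Relation.Nullary.Decidable using (yes; no)
open import Relation.Nullary.Negation using (¬_)
open import Relation.Unary using (Pred)

import Algebra.Properties.CommutativeMonoid.Mult as Mult
import Algebra.Properties.CommutativeMonoid.Sum as Sum
import Algebra.Properties.Ring as RingProperties
import Algebra.Solver.Ring.NaturalCoefficients.Default as Solver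
import Relation.Binary.Construct.NonStrictToStrict as NonStrictToStrict
import Relation.Binary.Reasoning.PartialOrder as ≤-Reasoning
import Relation.Binary.Reasoning.Setoid as ≈-Reasoning

module _ {a ℓ} {A : Set a} (_≤_ : Rel A ℓ) where

  IsUpperBound : ∀ {p} → Pred A p → A → Set _
  IsUpperBound P b = ∀ x → P x → x ≤ b

  record IsSupremum {p} (P : Pred A p) (s : A) : Set (a Level.⊔ ℓ Level.⊔ p) where
    field
      isUpperBound : IsUpperBound P s
      isLeast      : ∀ b → IsUpperBound P b → s ≤ b

-- Classically, the complete ordered fields are exactly the isomorphic copies
-- of ℝ, so a statement about ℝ is a statement about every such field.
-- The value of _⁻¹ at 0# is unspecified.
record CompleteOrderedField (ℓ : Level) : Set (suc ℓ) where
  infix  8 _⁻¹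
  infixl 7 _/_
  infix  4 _≤_

  field
    commutativeRing : CommutativeRing ℓ ℓ

  open CommutativeRing commutativeRing public

  field
    _⁻¹             : Carrier → Carrier
    _≤_             : Rel Carrier ℓ
    1≉0             : ¬ (1# ≈ 0#)
    ⁻¹-cong         : ∀ {x y} → x ≈ y → x ⁻¹ ≈ y ⁻¹
    ⁻¹-inverseʳ     : ∀ {x} → ¬ (x ≈ 0#) → x * x ⁻¹ ≈ 1#
    isDecTotalOrder : IsDecTotalOrder _≈_ _≤_
    +-monoˡ-≤       : ∀ z {x y} → x ≤ y → x + z ≤ y + z
    *-nonneg        : ∀ {x y} → 0# ≤ x → 0# ≤ y → 0# ≤ x * y
    complete        : (P : Pred Carrier ℓ) → ∃ P → ∃ (IsUpperBound _≤_ P) →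
                      ∃ (IsSupremum _≤_ P)

  open IsDecTotalOrder isDecTotalOrder public
    using (isPartialOrder; antisym; total; _≤?_; _≟_; ≤-respʳ-≈; ≤-respˡ-≈)
    renaming (refl to ≤-refl; reflexive to ≤-reflexive; trans to ≤-trans)

  open NonStrictToStrict _≈_ _≤_ public using (_<_)

  _/_ : Carrier → Carrier → Carrier
  x / y = x * y ⁻¹

  open Mult +-commutativeMonoid using () renaming (_×_ to _·_)
  open Sum +-commutativeMonoid public using (sum)

  fromℕ : ℕ → Carrier
  fromℕ n = n · 1#

  mean : ∀ {k} → Vector Carrier k → Carrier
  mean {k} a = (1# / fromℕ k) * sum a

  private
    poset : Poset ℓ ℓ ℓ
    poset = record { isPartialOrder = isPartialOrder }

    open RingProperties ring
    open Solver commutativeSemiring using (solve; _:+_; _:*_; _:=_)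

    +-monoʳ-≤ : ∀ z {x y} → x ≤ y → z + x ≤ z + y
    +-monoʳ-≤ z {x} {y} p =
      ≤-respˡ-≈ (+-comm x z) (≤-respʳ-≈ (+-comm y z) (+-monoˡ-≤ z p))

    +-cancelˡ-≤ : ∀ z {x y} → z + x ≤ z + y → x ≤ y
    +-cancelˡ-≤ z {x} {y} p = ≤-respˡ-≈ (lem x) (≤-respʳ-≈ (lem y) (+-monoʳ-≤ (- z) p))
      where
      lem : ∀ w → - z + (z + w) ≈ w
      lem w = trans (sym (+-assoc (- z) z w))
                (trans (+-congʳ (-‿inverseˡ z)) (+-identityˡ w))

    difference : ∀ x y → x ≤ y → ∃ λ d → 0# ≤ d × x + d ≈ y
    difference x y p = - x + y
      , ≤-respˡ-≈ (-‿inverseˡ x) (+-monoʳ-≤ (- x) p)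
      , trans (sym (+-assoc x (- x) y)) (trans (+-congʳ (-‿inverseʳ x)) (+-identityˡ y))

    +-nonneg : ∀ {x y} → 0# ≤ x → 0# ≤ y → 0# ≤ x + y
    +-nonneg {x} p q = ≤-trans p (≤-respˡ-≈ (+-identityʳ x) (+-monoʳ-≤ x q))

    x≤x+y : ∀ x {y} → 0# ≤ y → x ≤ x + y
    x≤x+y x p = ≤-respˡ-≈ (+-identityʳ x) (+-monoʳ-≤ x p)

    *-monoˡ-≤ : ∀ {z x y} → 0# ≤ z → x ≤ y → z * x ≤ z * y
    *-monoˡ-≤ {z} {x} {y} 0≤z x≤y with difference x y x≤y
    ... | d , 0≤d , x+d≈y = ≤-respʳ-≈ (trans (sym (distribˡ z x d)) (*-congˡ x+d≈y))
                              (x≤x+y (z * x) (*-nonneg 0≤z 0≤d))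

    *-mono-≤ : ∀ {x y} → 0# ≤ x → x ≤ y → x * x ≤ y * y
    *-mono-≤ {x} {y} 0≤x x≤y =
      ≤-trans (*-monoˡ-≤ 0≤x x≤y)
        (≤-respˡ-≈ (*-comm y x) (*-monoˡ-≤ (≤-trans 0≤x x≤y) x≤y))

    sq-nonneg : ∀ x → 0# ≤ x * x
    sq-nonneg x with total 0# x
    ... | inj₁ 0≤x = *-nonneg 0≤x 0≤x
    ... | inj₂ x≤0 = ≤-respʳ-≈ (-x*-x x) (*-nonneg 0≤-x 0≤-x)
      where
      0≤-x : 0# ≤ - x
      0≤-x = ≤-respˡ-≈ (-‿inverseˡ x) (≤-respʳ-≈ (+-identityʳ (- x)) (+-monoʳ-≤ (- x) x≤0))
      -x*-x : ∀ x → - x * - x ≈ x * x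
      -x*-x x = trans (sym (-‿distribˡ-* x (- x)))
                  (trans (-‿cong (sym (-‿distribʳ-* x x))) (-‿involutive (x * x)))

    0≤1 : 0# ≤ 1#
    0≤1 = ≤-respʳ-≈ (*-identityˡ 1#) (sq-nonneg 1#)

    *-cancel-0 : ∀ {x y} → ¬ (x ≈ 0#) → x * y ≈ 0# → y ≈ 0#
    *-cancel-0 {x} {y} x≉0 xy≈0 = begin
      y                 ≈⟨ *-identityˡ y ⟨
      1# * y            ≈⟨ *-congʳ (⁻¹-inverseʳ x≉0) ⟨
      x * x ⁻¹ * y      ≈⟨ solve 3 (λ a b c → a :* b :* c := b :* (a :* c)) refl x (x ⁻¹) y ⟩
      x ⁻¹ * (x * y)    ≈⟨ *-congˡ xy≈0 ⟩
      x ⁻¹ * 0#         ≈⟨ zeroʳ _ ⟩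
      0#                ∎
      where open ≈-Reasoning setoid

    quotient : ∀ {c} d → 0# ≤ c → ¬ (c ≈ 0#) → 0# ≤ d →
               ∃ λ e → 0# ≤ e × c * e ≈ d
    quotient {c} d 0≤c c≉0 0≤d = d * c ⁻¹ , *-nonneg 0≤d 0≤c⁻¹ , eq
      where
      c*c⁻¹*c⁻¹ : c * (c ⁻¹ * c ⁻¹) ≈ c ⁻¹
      c*c⁻¹*c⁻¹ = trans (sym (*-assoc _ _ _)) (trans (*-congʳ (⁻¹-inverseʳ c≉0)) (*-identityˡ _))
      0≤c⁻¹ : 0# ≤ c ⁻¹
      0≤c⁻¹ = ≤-respʳ-≈ c*c⁻¹*c⁻¹ (*-nonneg 0≤c (sq-nonneg (c ⁻¹)))
      eq : c * (d * c ⁻¹) ≈ d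
      eq = trans (solve 3 (λ a b e → a :* (b :* e) := (a :* e) :* b) refl c d (c ⁻¹))
             (trans (*-congʳ (⁻¹-inverseʳ c≉0)) (*-identityˡ d))

  -- The first summand makes √ x = 0 for negative x.
  SqrtSet : Carrier → Pred Carrier ℓ
  SqrtSet x y = y ≈ 0# ⊎ y * y ≤ x

  sqrtSupremum : ∀ x → ∃ (IsSupremum _≤_ (SqrtSet x))
  sqrtSupremum x = complete (SqrtSet x) (0# , inj₁ refl) (1# + x * x , bound)
    where
    1≤bound : 1# ≤ 1# + x * x
    1≤bound = x≤x+y 1# (sq-nonneg x)
    x≤bound : x ≤ 1# + x * x
    x≤bound with total x 1#
    ... | inj₁ x≤1 = ≤-trans x≤1 1≤bound
    ... | inj₂ 1≤x = ≤-trans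
      (≤-respˡ-≈ (*-identityʳ x) (*-monoˡ-≤ (≤-trans 0≤1 1≤x) 1≤x))
      (≤-respʳ-≈ (+-comm (x * x) 1#) (x≤x+y (x * x) 0≤1))
    bound : IsUpperBound _≤_ (SqrtSet x) (1# + x * x)
    bound y (inj₁ y≈0) = ≤-trans (≤-reflexive y≈0) (≤-trans 0≤1 1≤bound)
    bound y (inj₂ y²≤x) with total y 1#
    ... | inj₁ y≤1 = ≤-trans y≤1 1≤bound
    ... | inj₂ 1≤y = ≤-trans
      (≤-respˡ-≈ (*-identityʳ y) (*-monoˡ-≤ (≤-trans 0≤1 1≤y) 1≤y))
      (≤-trans y²≤x x≤bound)

  √ : Carrier → Carrier
  √ x = proj₁ (sqrtSupremum x)

  √-nonneg : ∀ x → 0# ≤ √ x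
  √-nonneg x = IsSupremum.isUpperBound (proj₂ (sqrtSupremum x)) 0# (inj₁ refl)

  √-square : ∀ {x} → 0# ≤ x → √ x * √ x ≈ x
  √-square {x} 0≤x = antisym s²≤x x≤s²
    where
    open IsSupremum (proj₂ (sqrtSupremum x))
    s : Carrier
    s = √ x
    0≤s : 0# ≤ s
    0≤s = √-nonneg x

    -- If s² + d = x, the element s + e with e = d / (2s + 1 + d) of the set
    -- forces e = 0.
    x≤s² : x ≤ s * s
    x≤s² with total x (s * s)
    ... | inj₁ p = p
    ... | inj₂ p with difference (s * s) x p
    ... | d , 0≤d , s²+d≈x = ≤-reflexive (sym s²≈x)
      where
      c : Carrier
      c = s + s + 1# + d
      1≤c : 1# ≤ c
      1≤c = ≤-respʳ-≈
        (solve 3 (λ o s d → o :+ (s :+ s :+ d) := s :+ s :+ o :+ d) refl 1# s d)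
        (x≤x+y 1# (+-nonneg (+-nonneg 0≤s 0≤s) 0≤d))
      c≉0 : ¬ (c ≈ 0#)
      c≉0 c≈0 = 1≉0 (antisym (≤-trans 1≤c (≤-reflexive c≈0)) 0≤1)
      q : ∃ λ e → 0# ≤ e × c * e ≈ d
      q = quotient d (≤-trans 0≤1 1≤c) c≉0 0≤d
      e : Carrier
      e = proj₁ q
      0≤e : 0# ≤ e
      0≤e = proj₁ (proj₂ q)
      ce≈d : c * e ≈ d
      ce≈d = proj₂ (proj₂ q)
      e≤1 : e ≤ 1#
      e≤1 with total e 1#
      ... | inj₁ r = r
      ... | inj₂ 1≤e = ⊥-elim (1≉0 (antisym 1≤0 0≤1))
        where
        c≤d : c ≤ d
        c≤d = ≤-respʳ-≈ ce≈d (≤-respˡ-≈ (*-identityʳ c) (*-monoˡ-≤ (≤-trans 0≤1 1≤c) 1≤e))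
        d+1≤d+0 : d + 1# ≤ d + 0#
        d+1≤d+0 = ≤-respʳ-≈ (sym (+-identityʳ d)) (≤-trans
          (≤-respʳ-≈
            (solve 3 (λ o s d → (d :+ o) :+ (s :+ s) := s :+ s :+ o :+ d) refl 1# s d)
            (x≤x+y (d + 1#) (+-nonneg 0≤s 0≤s)))
          c≤d)
        1≤0 : 1# ≤ 0#
        1≤0 = +-cancelˡ-≤ d d+1≤d+0
      [s+e]²≤x : (s + e) * (s + e) ≤ x
      [s+e]²≤x = begin
        (s + e) * (s + e)          ≈⟨ solve 2 (λ s e → (s :+ e) :* (s :+ e) := s :* s :+ (e :* (s :+ s) :+ e :* e)) refl s e ⟩
        s * s + (e * (s + s) + e * e) ≤⟨ +-monoʳ-≤ (s * s) (+-monoʳ-≤ (e * (s + s)) (*-monoˡ-≤ 0≤e e≤1)) ⟩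
        s * s + (e * (s + s) + e * 1#) ≤⟨ +-monoʳ-≤ (s * s) (x≤x+y _ (*-nonneg 0≤e 0≤d)) ⟩
        s * s + (e * (s + s) + e * 1# + e * d) ≈⟨ +-congˡ (solve 4 (λ o s e d → e :* (s :+ s) :+ e :* o :+ e :* d := (s :+ s :+ o :+ d) :* e) refl 1# s e d) ⟩
        s * s + c * e              ≈⟨ +-congˡ ce≈d ⟩
        s * s + d                  ≈⟨ s²+d≈x ⟩
        x                          ∎
        where open ≤-Reasoning poset
      e≈0 : e ≈ 0#
      e≈0 = antisym
        (+-cancelˡ-≤ s (≤-respʳ-≈ (sym (+-identityʳ s)) (isUpperBound (s + e) (inj₂ [s+e]²≤x))))
        0≤e
      s²≈x : s * s ≈ x
      s²≈x = trans (sym (+-identityʳ _))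
        (trans (+-congˡ (trans (sym (zeroʳ c)) (trans (*-congˡ (sym e≈0)) ce≈d))) s²+d≈x)

    -- If x + d = s² and s ≠ 0, the upper bound t = s - d / 2s of the set
    -- forces d = 0.
    s²≤x : s * s ≤ x
    s²≤x with total (s * s) x
    ... | inj₁ p = p
    ... | inj₂ p with difference x (s * s) p | s ≟ 0#
    ... | _ | yes s≈0 = ≤-trans (≤-reflexive (trans (*-congʳ s≈0) (zeroˡ s))) 0≤x
    ... | d , 0≤d , x+d≈s² | no s≉0 = ≤-reflexive (trans (sym x+d≈s²)
            (trans (+-congˡ d≈0) (+-identityʳ x)))
      where
      2s≉0 : ¬ (s + s ≈ 0#)
      2s≉0 2s≈0 = s≉0 (antisym (≤-respʳ-≈ 2s≈0 (x≤x+y s 0≤s)) 0≤s)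
      q : ∃ λ e → 0# ≤ e × (s + s) * e ≈ d
      q = quotient d (+-nonneg 0≤s 0≤s) 2s≉0 0≤d
      e : Carrier
      e = proj₁ q
      0≤e : 0# ≤ e
      0≤e = proj₁ (proj₂ q)
      2se≈d : (s + s) * e ≈ d
      2se≈d = proj₂ (proj₂ q)
      e≤s : e ≤ s
      e≤s with total e s
      ... | inj₁ r = r
      ... | inj₂ s≤e = ⊥-elim (s≉0 (*-cancel-0 s≉0 s²≈0))
        where
        f : ∃ λ f → 0# ≤ f × s + f ≈ e
        f = difference s e s≤e
        g : Carrier
        g = proj₁ f
        s+g≈e : s + g ≈ e
        s+g≈e = proj₂ (proj₂ f)
        rest : Carrier
        rest = s * s + (s + s) * g
        0≤rest : 0# ≤ rest
        0≤rest = +-nonneg (sq-nonneg s) (*-nonneg (+-nonneg 0≤s 0≤s) (proj₁ (proj₂ f)))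
        rest≤0 : rest ≤ 0#
        rest≤0 = +-cancelˡ-≤ (s * s) (begin
          s * s + rest     ≈⟨ solve 2 (λ s g → s :* s :+ (s :* s :+ (s :+ s) :* g) := (s :+ s) :* (s :+ g)) refl s g ⟩
          (s + s) * (s + g) ≈⟨ *-congˡ s+g≈e ⟩
          (s + s) * e      ≈⟨ 2se≈d ⟩
          d                ≤⟨ x≤x+y d 0≤x ⟩
          d + x            ≈⟨ +-comm d x ⟩
          x + d            ≈⟨ x+d≈s² ⟩
          s * s            ≈⟨ +-identityʳ _ ⟨
          s * s + 0#       ∎)
          where open ≤-Reasoning poset
        s²≈0 : s * s ≈ 0#
        s²≈0 = antisym
          (≤-trans (x≤x+y (s * s) (*-nonneg (+-nonneg 0≤s 0≤s) (proj₁ (proj₂ f)))) rest≤0)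
          (sq-nonneg s)
      h : ∃ λ t → 0# ≤ t × e + t ≈ s
      h = difference e s e≤s
      t : Carrier
      t = proj₁ h
      0≤t : 0# ≤ t
      0≤t = proj₁ (proj₂ h)
      e+t≈s : e + t ≈ s
      e+t≈s = proj₂ (proj₂ h)
      t²≈x+e² : t * t ≈ x + e * e
      t²≈x+e² = antisym (+-cancelˡ-≤ d (≤-reflexive eq)) (+-cancelˡ-≤ d (≤-reflexive (sym eq)))
        where
        eq : d + t * t ≈ d + (x + e * e)
        eq = begin
          d + t * t                    ≈⟨ +-congʳ 2se≈d ⟨
          (s + s) * e + t * t          ≈⟨ +-congʳ (*-congʳ (+-cong e+t≈s e+t≈s)) ⟨
          (e + t + (e + t)) * e + t * t ≈⟨ solve 2 (λ e t → (e :+ t :+ (e :+ t)) :* e :+ t :* t := (e :+ t) :* (e :+ t) :+ e :* e) refl e t ⟩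
          (e + t) * (e + t) + e * e    ≈⟨ +-congʳ (*-cong e+t≈s e+t≈s) ⟩
          s * s + e * e                ≈⟨ +-congʳ x+d≈s² ⟨
          x + d + e * e                ≈⟨ solve 3 (λ x d e → x :+ d :+ e :* e := d :+ (x :+ e :* e)) refl x d e ⟩
          d + (x + e * e)              ∎
          where open ≈-Reasoning setoid
      tBound : IsUpperBound _≤_ (SqrtSet x) t
      tBound y (inj₁ y≈0) = ≤-respˡ-≈ (sym y≈0) 0≤t
      tBound y (inj₂ y²≤x) with total y t
      ... | inj₁ r = r
      ... | inj₂ t≤y = ≤-trans y≤s (≤-reflexive (trans (sym e+t≈s) (trans (+-congʳ e≈0) (+-identityˡ t))))
        where
        y≤s : y ≤ s
        y≤s = isUpperBound y (inj₂ y²≤x)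
        e²≤0 : e * e ≤ 0#
        e²≤0 = +-cancelˡ-≤ x (≤-respˡ-≈ t²≈x+e²
          (≤-trans (*-mono-≤ 0≤t t≤y) (≤-respʳ-≈ (sym (+-identityʳ x)) y²≤x)))
        e≈0 : e ≈ 0#
        e≈0 with e ≟ 0#
        ... | yes r = r
        ... | no e≉0 = *-cancel-0 e≉0 (antisym e²≤0 (sq-nonneg e))
      e≤0 : e ≤ 0#
      e≤0 = +-cancelˡ-≤ t (≤-respˡ-≈ (trans (sym e+t≈s) (+-comm e t))
              (≤-respʳ-≈ (sym (+-identityʳ t)) (isLeast t tBound)))
      d≈0 : d ≈ 0#
      d≈0 = trans (sym 2se≈d) (trans (*-congˡ (antisym e≤0 0≤e)) (zeroʳ _))

module TimeSeriesSearch {ℓ : Level} (ℝ : CompleteOrderedField ℓ) where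
  open CompleteOrderedField ℝ

  module _ {k : ℕ} (m M : Vector Carrier k) where

    fluctuationRatio : Vector Carrier k
    fluctuationRatio i = M i / m i

    𝒮 : Pred (Vector Carrier k) ℓ
    𝒮 x = (∀ i → m i ≤ x i × x i ≤ M i)
        × mean (λ i → x i / m i) ≈ mean (λ i → M i / x i)

    Values : Pred Carrier ℓ
    Values v = ∃ λ x → 𝒮 x × v ≈ mean (λ i → M i / x i)

    -- z is the arithmetic mean component competitive ratio; suprema are
    -- unique up to _≈_.
    IsMeanComponentCompetitiveRatio : Carrier → Set ℓ
    IsMeanComponentCompetitiveRatio = IsSupremum _≤_ Values

{-# OPTIONS --safe #-}

-- Write x i / m i = 1 + p i and M i / x i = 1 + q i with p, q ≥ 0, and
-- a i = r i − 1 = p i + q i + p i q i. The constraint is Σ p = Σ q, and twice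
-- the sum of the M i / x i is Σ (2 + a i) − Σ p i q i, so Σ p i q i is to be
-- minimised. The claimed minimum is P Q, where 1 + P and 1 + Q are the halves
-- of √ (4 r₄ + δ²) ± δ, so that P + Q + P Q = a₄ and P − Q = δ; it is attained
-- at (m₁ , M₂ , M₃ , m₄ (1 + P)).
--
-- For the lower bound let W ≤ M be P and Q in order. The distance t of q − p to
-- the ends of [− a , a] is w (2 + m), where w ≤ m are p and q in order. Since
-- the q i − p i add up to 0, the t i add up to at least |Σ ± a i| for some choice
-- of signs, hence to at least a₄ − |δ| = W (2 + M). If every m i ≥ M, then
-- p q = t m / (2 + m) ≥ t M / (2 + M) termwise and summation gives the bound;
-- if some m i < M, then p i q i ≥ W M already, because a i ≥ a₄.
module Submission where

open import Defs
open import Data.Empty using (⊥-elim)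
open import Data.Fin.Base using (Fin)
open import Data.Fin.Patterns using (0F; 1F; 2F; 3F)
open import Data.Nat.Base using (zero; suc)
open import Data.Product.Base using (∃; ∃₂; _×_; _,_; proj₁; proj₂)
open import Data.Sum.Base using (_⊎_; inj₁; inj₂)
open import Data.Vec.Functional using (Vector)
open import Level using (Level)
open import Relation.Binary.Bundles using (Poset)
open import Relation.Nullary.Decidable using (yes; no)
open import Relation.Nullary.Negation using (¬_)

import Algebra.Properties.Ring as RingProperties
import Algebra.Solver.Ring.NaturalCoefficients.Default as Solver
import Relation.Binary.Reasoning.PartialOrder as ≤-Reasoning

-- Inequalities, cancellation and inverses in an ordered field.

module OrderedFieldProperties {ℓ : Level} (ℝ : CompleteOrderedField ℓ) where
  open CompleteOrderedField ℝ
  open Solver commutativeSemiring public using (solve; con; _:+_; _:*_; _:=_)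
  open RingProperties ring public using (-‿distribˡ-*; -‿distribʳ-*; -‿involutive)

  poset : Poset ℓ ℓ ℓ
  poset = record { isPartialOrder = isPartialOrder }

  +-monoʳ-≤ : ∀ z {x y} → x ≤ y → z + x ≤ z + y
  +-monoʳ-≤ z {x} {y} p =
    ≤-respˡ-≈ (+-comm x z) (≤-respʳ-≈ (+-comm y z) (+-monoˡ-≤ z p))

  +-mono-≤ : ∀ {x y z w} → x ≤ y → z ≤ w → x + z ≤ y + w
  +-mono-≤ {y = y} {z} p q = ≤-trans (+-monoˡ-≤ z p) (+-monoʳ-≤ y q)

  +-nonneg : ∀ {x y} → 0# ≤ x → 0# ≤ y → 0# ≤ x + y
  +-nonneg p q = ≤-respˡ-≈ (+-identityʳ 0#) (+-mono-≤ p q)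

  x≤x+y : ∀ {x y} → 0# ≤ y → x ≤ x + y
  x≤x+y {x} p = ≤-respˡ-≈ (+-identityʳ x) (+-monoʳ-≤ x p)

  x-y+y≈x : ∀ x y → x - y + y ≈ x
  x-y+y≈x x y = trans (+-assoc x (- y) y) (trans (+-congˡ (-‿inverseˡ y)) (+-identityʳ x))

  +-cancelʳ-≤ : ∀ z {x y} → x + z ≤ y + z → x ≤ y
  +-cancelʳ-≤ z {x} {y} p = ≤-respˡ-≈ (lem x) (≤-respʳ-≈ (lem y) (+-monoˡ-≤ (- z) p))
    where
    lem : ∀ w → w + z - z ≈ w
    lem w = trans (+-assoc w z (- z)) (trans (+-congˡ (-‿inverseʳ z)) (+-identityʳ w))

  -- Both combination rules avoid subtraction, so that their second premise
  -- is a commutative semiring identity.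
  linear-≤ : ∀ {l r x y} → l ≤ r → x + r ≈ y + l → x ≤ y
  linear-≤ {l} {r} {x} l≤r x+r≈y+l =
    +-cancelʳ-≤ l (≤-respʳ-≈ x+r≈y+l (+-monoʳ-≤ x l≤r))

  linear-≈ : ∀ {l r x y} → l ≈ r → x + r ≈ y + l → x ≈ y
  linear-≈ {l} {r} l≈r x+r≈y+l = antisym
    (linear-≤ (≤-reflexive l≈r) x+r≈y+l)
    (linear-≤ (≤-reflexive l≈r) (trans (+-congˡ (sym l≈r)) (trans (sym x+r≈y+l) (+-congˡ (sym l≈r)))))

  difference : ∀ {x y} → x ≤ y → ∃ λ d → 0# ≤ d × x + d ≈ y
  difference {x} {y} p = y - x
    , ≤-respˡ-≈ (-‿inverseʳ x) (+-monoˡ-≤ (- x) p)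
    , trans (+-comm x (y - x)) (x-y+y≈x y x)

  *-monoˡ-≤ : ∀ {z x y} → 0# ≤ z → x ≤ y → z * x ≤ z * y
  *-monoˡ-≤ {z} {x} {y} 0≤z x≤y with difference x≤y
  ... | d , 0≤d , x+d≈y =
    ≤-respʳ-≈ (trans (sym (distribˡ z x d)) (*-congˡ x+d≈y)) (x≤x+y (*-nonneg 0≤z 0≤d))

  rearrangement : ∀ {x y z w} → x ≤ y → z ≤ w → x * w + y * z ≤ x * z + y * w
  rearrangement {x} {y} {z} {w} x≤y z≤w with difference x≤y
  ... | d , 0≤d , x+d≈y = begin
    x * w + y * z             ≈⟨ +-congˡ (*-congʳ x+d≈y) ⟨
    x * w + (x + d) * z       ≈⟨ solve 4 (λ x z w d → x :* w :+ (x :+ d) :* z := (x :* z :+ x :* w) :+ d :* z) refl x z w d ⟩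
    x * z + x * w + d * z     ≤⟨ +-monoʳ-≤ _ (*-monoˡ-≤ 0≤d z≤w) ⟩
    x * z + x * w + d * w     ≈⟨ solve 4 (λ x z w d → (x :* z :+ x :* w) :+ d :* w := x :* z :+ (x :+ d) :* w) refl x z w d ⟩
    x * z + (x + d) * w       ≈⟨ +-congˡ (*-congʳ x+d≈y) ⟩
    x * z + y * w             ∎
    where open ≤-Reasoning poset

  square-nonneg : ∀ x → 0# ≤ x * x
  square-nonneg x with total 0# x
  ... | inj₁ 0≤x = *-nonneg 0≤x 0≤x
  ... | inj₂ x≤0 = ≤-respʳ-≈ -x*-x≈x*x (*-nonneg 0≤-x 0≤-x)
    where
    0≤-x : 0# ≤ - x
    0≤-x = ≤-respˡ-≈ (-‿inverseʳ x) (≤-respʳ-≈ (+-identityˡ (- x)) (+-monoˡ-≤ (- x) x≤0))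
    -x*-x≈x*x : - x * - x ≈ x * x
    -x*-x≈x*x = trans (sym (-‿distribˡ-* x (- x)))
      (trans (-‿cong (sym (-‿distribʳ-* x x))) (-‿involutive (x * x)))

  0≤1 : 0# ≤ 1#
  0≤1 = ≤-respʳ-≈ (*-identityˡ 1#) (square-nonneg 1#)

  fromℕ-nonneg : ∀ n → 0# ≤ fromℕ n
  fromℕ-nonneg zero    = ≤-reflexive refl
  fromℕ-nonneg (suc n) = +-nonneg 0≤1 (fromℕ-nonneg n)

  1+x≉0 : ∀ {x} → 0# ≤ x → ¬ (1# + x ≈ 0#)
  1+x≉0 0≤x 1+x≈0 = 1≉0 (antisym (≤-respʳ-≈ 1+x≈0 (x≤x+y 0≤x)) 0≤1)

  -- The inverse is `x` times the square of `x ⁻¹`.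
  ⁻¹-nonneg : ∀ {x} → 0# ≤ x → ¬ (x ≈ 0#) → 0# ≤ x ⁻¹
  ⁻¹-nonneg {x} 0≤x x≉0 = ≤-respʳ-≈
    (trans (sym (*-assoc _ _ _)) (trans (*-congʳ (⁻¹-inverseʳ x≉0)) (*-identityˡ _)))
    (*-nonneg 0≤x (square-nonneg (x ⁻¹)))

  ⁻¹-*-cancelˡ : ∀ {x} y → ¬ (x ≈ 0#) → x ⁻¹ * (x * y) ≈ y
  ⁻¹-*-cancelˡ {x} y x≉0 = trans
    (solve 3 (λ x i y → i :* (x :* y) := x :* i :* y) refl x (x ⁻¹) y)
    (trans (*-congʳ (⁻¹-inverseʳ x≉0)) (*-identityˡ y))

  *-cancelˡ-≈ : ∀ {z x y} → ¬ (z ≈ 0#) → z * x ≈ z * y → x ≈ y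
  *-cancelˡ-≈ {z} {x} {y} z≉0 zx≈zy =
    trans (sym (⁻¹-*-cancelˡ x z≉0)) (trans (*-congˡ zx≈zy) (⁻¹-*-cancelˡ y z≉0))

  *-cancelˡ-≤ : ∀ {z x y} → 0# ≤ z → ¬ (z ≈ 0#) → z * x ≤ z * y → x ≤ y
  *-cancelˡ-≤ {z} {x} {y} 0≤z z≉0 zx≤zy =
    ≤-respˡ-≈ (⁻¹-*-cancelˡ x z≉0) (≤-respʳ-≈ (⁻¹-*-cancelˡ y z≉0)
      (*-monoˡ-≤ (⁻¹-nonneg 0≤z z≉0) zx≤zy))

  2≉0 : ¬ (1# + 1# ≈ 0#)
  2≉0 = 1+x≉0 0≤1

  double-cancel-≈ : ∀ {x y} → x + x ≈ y + y → x ≈ y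
  double-cancel-≈ {x} {y} 2x≈2y = *-cancelˡ-≈ 2≉0
    (trans (lem x) (trans 2x≈2y (sym (lem y))))
    where
    lem : ∀ x → (1# + 1#) * x ≈ x + x
    lem = solve 1 (λ x → con 2 :* x := x :+ x) refl

  double-cancel-nonneg : ∀ {x} → 0# ≤ x + x → 0# ≤ x
  double-cancel-nonneg {x} 0≤2x with total 0# x
  ... | inj₁ 0≤x = 0≤x
  ... | inj₂ x≤0 = linear-≤ (+-mono-≤ 0≤2x x≤0)
    (solve 1 (λ x → con 0 :+ (x :+ x :+ con 0) := x :+ (con 0 :+ x)) refl x)

  -- If instead `x` is `y + e` with `e` nonnegative, then `e * e` is at most `x * x - y * y`, hence
  -- zero.
  square-cancel-≤ : ∀ {x y} → 0# ≤ y → x * x ≤ y * y → x ≤ y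
  square-cancel-≤ {x} {y} 0≤y x²≤y² with total x y
  ... | inj₁ x≤y = x≤y
  ... | inj₂ y≤x with difference y≤x
  ... | e , 0≤e , y+e≈x with e ≟ 0#
  ... | yes e≈0 = ≤-reflexive (trans (sym y+e≈x) (trans (+-congˡ e≈0) (+-identityʳ y)))
  ... | no e≉0 = ⊥-elim (e≉0 (*-cancelˡ-≈ e≉0 (trans e²≈0 (sym (zeroʳ e)))))
    where
    [y+e]²≤y² : (y + e) * (y + e) ≤ y * y
    [y+e]²≤y² = ≤-respˡ-≈ (sym (*-cong y+e≈x y+e≈x)) x²≤y²
    e²≈0 : e * e ≈ 0#
    e²≈0 = antisym
      (linear-≤ (+-mono-≤ [y+e]²≤y² (+-nonneg (*-nonneg 0≤y 0≤e) (*-nonneg 0≤y 0≤e)))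
        (solve 2 (λ y e → e :* e :+ (y :* y :+ (y :* e :+ y :* e))
                        := con 0 :+ ((y :+ e) :* (y :+ e) :+ con 0)) refl y e))
      (square-nonneg e)

module _ {ℓ : Level} (ℝ : CompleteOrderedField ℓ) where
  open CompleteOrderedField ℝ
  open OrderedFieldProperties ℝ

  -- The slack of one coordinate.

  -- t is the distance a − |q − p| of q − p to the ends of [− a , a], for
  -- a = p + q + p q. Either p q ≥ W M, or p q / t ≥ M / (2 + M), the value of
  -- this quotient at the pair (W , M).
  record Slack (W M p q t : Carrier) : Set ℓ where
    field
      t≥0   : 0# ≤ t
      t≤a-y : t + q ≤ p + q + p * q + p
      t≤a+y : t + p ≤ p + q + p * q + q
      tight : (p + q + p * q + p ≤ t + q) ⊎ (p + q + p * q + q ≤ t + p)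
      gain  : (W * M ≤ p * q) ⊎ (M * t ≤ (1# + 1# + M) * (p * q))

  -- For `p ≤ q` the nearer end is `a` itself, and a - (q - p) = p (2 + q). The two kinds of `gain`
  -- come from the position of `q` relative to `M` and `W`.
  slack-≤ : ∀ {W M p q} → 0# ≤ p → 0# ≤ q → p ≤ q →
            W + M + W * M ≤ p + q + p * q → Slack W M p q (p + p + p * q)
  slack-≤ {W} {M} {p} {q} 0≤p 0≤q p≤q A≤a = record
    { t≥0   = +-nonneg (+-nonneg 0≤p 0≤p) (*-nonneg 0≤p 0≤q)
    ; t≤a-y = ≤-reflexive (solve 2 (λ p q → p :+ p :+ p :* q :+ q := p :+ q :+ p :* q :+ p) refl p q)
    ; t≤a+y = linear-≤ (+-mono-≤ p≤q p≤q)
        (solve 2 (λ p q → p :+ p :+ p :* q :+ p :+ (q :+ q) := p :+ q :+ p :* q :+ q :+ (p :+ p)) refl p q)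
    ; tight = inj₁ (≤-reflexive (solve 2 (λ p q → p :+ q :+ p :* q :+ p := p :+ p :+ p :* q :+ q) refl p q))
    ; gain  = gain
    }
    where
    gain : (W * M ≤ p * q) ⊎ (M * (p + p + p * q) ≤ (1# + 1# + M) * (p * q))
    gain with total M q
    -- Both sides contain M p q; what remains is 2 p M ≤ 2 p q.
    ... | inj₁ M≤q = inj₂ (linear-≤ (*-monoˡ-≤ (+-nonneg 0≤p 0≤p) M≤q)
            (solve 3 (λ M p q → M :* (p :+ p :+ p :* q) :+ (p :+ p) :* q
                             := (con 2 :+ M) :* (p :* q) :+ (p :+ p) :* M) refl M p q))
    ... | inj₂ q≤M with total W q
    -- Since (1 + q) p = a - q, the hypothesis `A≤a` gives (1 + q) (p q - W M) ≥ (q - W) (M - q),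
    -- which is nonnegative here.
    ...   | inj₁ W≤q = inj₁ (*-cancelˡ-≤ (+-nonneg 0≤1 0≤q) (1+x≉0 0≤q)
              (linear-≤ (+-mono-≤ (*-monoˡ-≤ 0≤q A≤a) (rearrangement W≤q q≤M))
                (solve 4 (λ W M p q →
                     (con 1 :+ q) :* (W :* M) :+ (q :* (p :+ q :+ p :* q) :+ (W :* q :+ q :* M))
                  := (con 1 :+ q) :* (p :* q) :+ (q :* (W :+ M :+ W :* M) :+ (W :* M :+ q :* q)))
                  refl W M p q)))
    -- Now p + q ≤ W + M, so `A≤a` forces the products into the opposite order.
    ...   | inj₂ q≤W = inj₁ (linear-≤ (+-mono-≤ A≤a (+-mono-≤ (≤-trans p≤q q≤W) q≤M))
              (solve 4 (λ W M p q →
                   W :* M :+ (p :+ q :+ p :* q :+ (W :+ M))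
                := p :* q :+ (W :+ M :+ W :* M :+ (p :+ q)))
                refl W M p q))

  swap-sum : ∀ p q → p + q + p * q ≈ q + p + q * p
  swap-sum = solve 2 (λ p q → p :+ q :+ p :* q := q :+ p :+ q :* p) refl

  -- Exchanging `p` and `q` reflects q - p in the symmetric interval [- a , a], so the same `t`
  -- serves.
  slack-swap : ∀ {W M p q t} → Slack W M p q t → Slack W M q p t
  slack-swap {W} {M} {p} {q} {t} s = record
    { t≥0   = t≥0
    ; t≤a-y = ≤-respʳ-≈ (+-congʳ (swap-sum p q)) t≤a+y
    ; t≤a+y = ≤-respʳ-≈ (+-congʳ (swap-sum p q)) t≤a-y
    ; tight = tight′ tight
    ; gain  = gain′ gain
    }
    where
    open Slack s
    tight′ : (p + q + p * q + p ≤ t + q) ⊎ (p + q + p * q + q ≤ t + p) →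
             (q + p + q * p + q ≤ t + p) ⊎ (q + p + q * p + p ≤ t + q)
    tight′ (inj₁ h) = inj₂ (≤-respˡ-≈ (+-congʳ (swap-sum p q)) h)
    tight′ (inj₂ h) = inj₁ (≤-respˡ-≈ (+-congʳ (swap-sum p q)) h)
    gain′ : (W * M ≤ p * q) ⊎ (M * t ≤ (1# + 1# + M) * (p * q)) →
            (W * M ≤ q * p) ⊎ (M * t ≤ (1# + 1# + M) * (q * p))
    gain′ (inj₁ h) = inj₁ (≤-respʳ-≈ (*-comm p q) h)
    gain′ (inj₂ h) = inj₂ (≤-respʳ-≈ (*-congˡ (*-comm p q)) h)

  slack : ∀ {W M p q} → 0# ≤ p → 0# ≤ q →
          W + M + W * M ≤ p + q + p * q → ∃ (Slack W M p q)
  slack {W} {M} {p} {q} 0≤p 0≤q A≤a with total p q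
  ... | inj₁ p≤q = _ , slack-≤ 0≤p 0≤q p≤q A≤a
  ... | inj₂ q≤p = _ , slack-swap (slack-≤ 0≤q 0≤p q≤p (≤-respʳ-≈ (swap-sum p q) A≤a))

  -- Lower bound for the sum of the slacks.

  module _ {W M T : Carrier} (a p q t : Vector Carrier 4)
           (a≈ : ∀ i → p i + q i + p i * q i ≈ a i)
           (s : ∀ i → Slack W M (p i) (q i) (t i)) where

    -- With y = q − p: if y i = a i − t i and y j = a j − t j, then the other
    -- two y's must compensate, and they are bounded below by t − a.
    slack-agree : ∀ i j k l →
      p i + p j + p k + p l ≈ q i + q j + q k + q l →
      a i + p i ≤ t i + q i → a j + p j ≤ t j + q j →
      T + (a k + a l) ≤ a i + a j →
      T ≤ t i + t j + t k + t l
    slack-agree i j k l Σp≈Σq hi hj hT = linear-≤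
      (+-mono-≤ (+-mono-≤ (+-mono-≤ hi hj) (+-mono-≤ (up k) (up l)))
        (+-mono-≤ (+-mono-≤ hT (≤-reflexive (sym Σp≈Σq)))
          (+-mono-≤ (+-nonneg (Slack.t≥0 (s k)) (Slack.t≥0 (s l)))
                    (+-nonneg (Slack.t≥0 (s k)) (Slack.t≥0 (s l))))))
      (solve 17 (λ T ai aj ak al pi pj pk pl qi qj qk ql ti tj tk tl →
           T :+ (ti :+ qi :+ (tj :+ qj) :+ (ak :+ qk :+ (al :+ ql))
                 :+ (ai :+ aj :+ (pi :+ pj :+ pk :+ pl) :+ (tk :+ tl :+ (tk :+ tl))))
        := ti :+ tj :+ tk :+ tl :+ (ai :+ pi :+ (aj :+ pj) :+ (tk :+ pk :+ (tl :+ pl))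
                 :+ (T :+ (ak :+ al) :+ (qi :+ qj :+ qk :+ ql) :+ (con 0 :+ con 0))))
        refl T (a i) (a j) (a k) (a l) (p i) (p j) (p k) (p l)
        (q i) (q j) (q k) (q l) (t i) (t j) (t k) (t l))
      where
      up : ∀ i → t i + p i ≤ a i + q i
      up i = ≤-respʳ-≈ (+-congʳ (a≈ i)) (Slack.t≤a+y (s i))

    -- Write y = q - p; by `h₀` the first y is closest to its upper end. If some other y is too,
    -- `slack-agree` applies to that pair. Otherwise the remaining three are closest to their lower
    -- ends, and only the first can balance them.
    slack-sum-≥0 :
      p 0F + p 1F + p 2F + p 3F ≈ q 0F + q 1F + q 2F + q 3F →
      a 0F + p 0F ≤ t 0F + q 0F →
      a 2F ≤ a 1F → a 3F ≤ a 2F →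
      T + (a 1F + a 2F) ≤ a 0F + a 3F →
      T + a 0F ≤ a 1F + a 2F + a 3F →
      T ≤ t 0F + t 1F + t 2F + t 3F
    slack-sum-≥0 Σp≈Σq h₀ a₂≤a₁ a₃≤a₂ hT hT′
      with Slack.tight (s 1F) | Slack.tight (s 2F) | Slack.tight (s 3F)
    ... | inj₁ h | _ | _ = slack-agree 0F 1F 2F 3F Σp≈Σq h₀ (≤-respˡ-≈ (+-congʳ (a≈ 1F)) h)
      -- The pair of indices 0 and 3 has the smallest surplus over its complement, so `hT` for it
      -- implies the inequality for this pair.
      (linear-≤ (+-mono-≤ hT (+-mono-≤ a₃≤a₁ a₃≤a₁))
        (solve 5 (λ T a₀ a₁ a₂ a₃ → T :+ (a₂ :+ a₃) :+ (a₀ :+ a₃ :+ (a₁ :+ a₁))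
                                 := a₀ :+ a₁ :+ (T :+ (a₁ :+ a₂) :+ (a₃ :+ a₃)))
          refl T (a 0F) (a 1F) (a 2F) (a 3F)))
      where
      a₃≤a₁ : a 3F ≤ a 1F
      a₃≤a₁ = ≤-trans a₃≤a₂ a₂≤a₁
    ... | inj₂ _ | inj₁ h | _ = ≤-respʳ-≈
      (solve 4 (λ x y z w → x :+ z :+ y :+ w := x :+ y :+ z :+ w) refl (t 0F) (t 1F) (t 2F) (t 3F))
      (slack-agree 0F 2F 1F 3F
        (trans (swap₁₂ p) (trans Σp≈Σq (sym (swap₁₂ q))))
        h₀ (≤-respˡ-≈ (+-congʳ (a≈ 2F)) h)
        (linear-≤ (+-mono-≤ hT (+-mono-≤ a₃≤a₂ a₃≤a₂))
          (solve 5 (λ T a₀ a₁ a₂ a₃ → T :+ (a₁ :+ a₃) :+ (a₀ :+ a₃ :+ (a₂ :+ a₂))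
                                   := a₀ :+ a₂ :+ (T :+ (a₁ :+ a₂) :+ (a₃ :+ a₃)))
            refl T (a 0F) (a 1F) (a 2F) (a 3F))))
      where
      swap₁₂ : ∀ (f : Vector Carrier 4) → f 0F + f 2F + f 1F + f 3F ≈ f 0F + f 1F + f 2F + f 3F
      swap₁₂ f = solve 4 (λ x y z w → x :+ z :+ y :+ w := x :+ y :+ z :+ w) refl (f 0F) (f 1F) (f 2F) (f 3F)
    ... | inj₂ _ | inj₂ _ | inj₁ h = ≤-respʳ-≈ (rotate t)
      (slack-agree 0F 3F 1F 2F
        (trans (rotate p) (trans Σp≈Σq (sym (rotate q))))
        h₀ (≤-respˡ-≈ (+-congʳ (a≈ 3F)) h) hT)
      where
      rotate : ∀ (f : Vector Carrier 4) → f 0F + f 3F + f 1F + f 2F ≈ f 0F + f 1F + f 2F + f 3F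
      rotate f = solve 4 (λ x y z w → x :+ w :+ y :+ z := x :+ y :+ z :+ w) refl (f 0F) (f 1F) (f 2F) (f 3F)
    -- Here y is at most t - a at the indices 1, 2, 3 and at most a - t at 0. As the y add up to 0,
    -- the last three t exceed the first by at least a₁ + a₂ + a₃ - a₀, which `hT′` bounds below by
    -- `T`.
    ... | inj₂ h₁ | inj₂ h₂ | inj₂ h₃ = linear-≤
      (+-mono-≤
        (+-mono-≤ (+-mono-≤ (down 1F h₁) (down 2F h₂))
                  (+-mono-≤ (down 3F h₃) (≤-respʳ-≈ (+-congʳ (a≈ 0F)) (Slack.t≤a-y (s 0F)))))
        (+-mono-≤ (+-mono-≤ hT′ (≤-reflexive Σp≈Σq))
                  (+-nonneg (Slack.t≥0 (s 0F)) (Slack.t≥0 (s 0F)))))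
      (solve 17 (λ T a₀ a₁ a₂ a₃ p₀ p₁ p₂ p₃ q₀ q₁ q₂ q₃ t₀ t₁ t₂ t₃ →
           T :+ (t₁ :+ p₁ :+ (t₂ :+ p₂) :+ (t₃ :+ p₃ :+ (a₀ :+ p₀))
                 :+ (a₁ :+ a₂ :+ a₃ :+ (q₀ :+ q₁ :+ q₂ :+ q₃) :+ (t₀ :+ t₀)))
        := t₀ :+ t₁ :+ t₂ :+ t₃
              :+ (a₁ :+ q₁ :+ (a₂ :+ q₂) :+ (a₃ :+ q₃ :+ (t₀ :+ q₀))
                 :+ (T :+ a₀ :+ (p₀ :+ p₁ :+ p₂ :+ p₃) :+ con 0)))
        refl T (a 0F) (a 1F) (a 2F) (a 3F) (p 0F) (p 1F) (p 2F) (p 3F)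
        (q 0F) (q 1F) (q 2F) (q 3F) (t 0F) (t 1F) (t 2F) (t 3F))
      where
      down : ∀ i → p i + q i + p i * q i + q i ≤ t i + p i → a i + q i ≤ t i + p i
      down i = ≤-respˡ-≈ (+-congʳ (a≈ i))

  -- Exchanging `p` and `q` in all coordinates reverses every q - p and keeps `a` and `t`, so the
  -- first difference may be taken closest to its upper end.
  slack-sum : ∀ {W M T} (a p q t : Vector Carrier 4) →
    (∀ i → p i + q i + p i * q i ≈ a i) →
    (∀ i → Slack W M (p i) (q i) (t i)) →
    p 0F + p 1F + p 2F + p 3F ≈ q 0F + q 1F + q 2F + q 3F →
    a 2F ≤ a 1F → a 3F ≤ a 2F →
    T + (a 1F + a 2F) ≤ a 0F + a 3F →
    T + a 0F ≤ a 1F + a 2F + a 3F →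
    T ≤ t 0F + t 1F + t 2F + t 3F
  slack-sum a p q t a≈ s Σp≈Σq with Slack.tight (s 0F)
  ... | inj₁ h = slack-sum-≥0 a p q t a≈ s Σp≈Σq (≤-respˡ-≈ (+-congʳ (a≈ 0F)) h)
  ... | inj₂ h = slack-sum-≥0 a q p t (λ i → trans (swap-sum (q i) (p i)) (a≈ i))
    (λ i → slack-swap (s i)) (sym Σp≈Σq) (≤-respˡ-≈ (+-congʳ (a≈ 0F)) h)

  -- Lower bound for the sum of the products.

  -- `W + W + W * M` is the slack of the pair (W , M). The last two hypotheses bound it by a₃ - |a₀
  -- - a₁ - a₂|, with indices from 0, one for each sign of the absolute value.
  product-sum-≤ : ∀ {W M} (a p q : Vector Carrier 4) → 0# ≤ M →
    (∀ i → 0# ≤ p i) → (∀ i → 0# ≤ q i) →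
    (∀ i → p i + q i + p i * q i ≈ a i) →
    (∀ i → W + M + W * M ≤ a i) →
    p 0F + p 1F + p 2F + p 3F ≈ q 0F + q 1F + q 2F + q 3F →
    a 2F ≤ a 1F → a 3F ≤ a 2F →
    W + W + W * M + (a 1F + a 2F) ≤ a 0F + a 3F →
    W + W + W * M + a 0F ≤ a 1F + a 2F + a 3F →
    W * M ≤ p 0F * q 0F + p 1F * q 1F + p 2F * q 2F + p 3F * q 3F
  product-sum-≤ {W} {M} a p q 0≤M 0≤p 0≤q a≈ A≤a Σp≈Σq a₂≤a₁ a₃≤a₂ hT hT′ = combine
    (Slack.gain (s 0F)) (Slack.gain (s 1F)) (Slack.gain (s 2F)) (Slack.gain (s 3F))
    where
    sl : ∀ i → ∃ (Slack W M (p i) (q i))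
    sl i = slack (0≤p i) (0≤q i) (≤-respʳ-≈ (sym (a≈ i)) (A≤a i))
    t : Vector Carrier 4
    t i = proj₁ (sl i)
    s : ∀ i → Slack W M (p i) (q i) (t i)
    s i = proj₂ (sl i)
    0≤pq : ∀ i → 0# ≤ p i * q i
    0≤pq i = *-nonneg (0≤p i) (0≤q i)
    Gain : Fin 4 → Set ℓ
    Gain i = (W * M ≤ p i * q i) ⊎ (M * t i ≤ (1# + 1# + M) * (p i * q i))
    x≤y+x : ∀ {x y} → 0# ≤ y → x ≤ y + x
    x≤y+x {x} {y} 0≤y = ≤-respʳ-≈ (+-comm x y) (x≤x+y 0≤y)
    combine : Gain 0F → Gain 1F → Gain 2F → Gain 3F →
      W * M ≤ p 0F * q 0F + p 1F * q 1F + p 2F * q 2F + p 3F * q 3F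
    combine (inj₁ g) _ _ _ = ≤-trans g
      (≤-trans (x≤x+y (0≤pq 1F)) (≤-trans (x≤x+y (0≤pq 2F)) (x≤x+y (0≤pq 3F))))
    combine (inj₂ _) (inj₁ g) _ _ = ≤-trans g
      (≤-trans (x≤y+x (0≤pq 0F)) (≤-trans (x≤x+y (0≤pq 2F)) (x≤x+y (0≤pq 3F))))
    combine (inj₂ _) (inj₂ _) (inj₁ g) _ = ≤-trans g
      (≤-trans (x≤y+x (+-nonneg (0≤pq 0F) (0≤pq 1F))) (x≤x+y (0≤pq 3F)))
    combine (inj₂ _) (inj₂ _) (inj₂ _) (inj₁ g) = ≤-trans g
      (x≤y+x (+-nonneg (+-nonneg (0≤pq 0F) (0≤pq 1F)) (0≤pq 2F)))
    -- No single term is known to reach `W * M`: the four bounds on the quotients are added and 2 +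
    -- M is cancelled.
    combine (inj₂ g₀) (inj₂ g₁) (inj₂ g₂) (inj₂ g₃) =
      *-cancelˡ-≤ (+-nonneg (+-nonneg 0≤1 0≤1) 0≤M)
        (λ e → 1+x≉0 (+-nonneg 0≤1 0≤M) (trans (sym (+-assoc _ _ _)) e))
        (begin
          (1# + 1# + M) * (W * M)
            ≈⟨ solve 2 (λ W M → (con 2 :+ M) :* (W :* M) := M :* (W :+ W :+ W :* M)) refl W M ⟩
          M * (W + W + W * M)
            ≤⟨ *-monoˡ-≤ 0≤M (slack-sum a p q t a≈ s Σp≈Σq a₂≤a₁ a₃≤a₂ hT hT′) ⟩
          M * (t 0F + t 1F + t 2F + t 3F)
            ≈⟨ factor M (t 0F) (t 1F) (t 2F) (t 3F) ⟨
          M * t 0F + M * t 1F + M * t 2F + M * t 3F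
            ≤⟨ +-mono-≤ (+-mono-≤ (+-mono-≤ g₀ g₁) g₂) g₃ ⟩
          (1# + 1# + M) * (p 0F * q 0F) + (1# + 1# + M) * (p 1F * q 1F)
            + (1# + 1# + M) * (p 2F * q 2F) + (1# + 1# + M) * (p 3F * q 3F)
            ≈⟨ factor _ _ _ _ _ ⟩
          (1# + 1# + M) * (p 0F * q 0F + p 1F * q 1F + p 2F * q 2F + p 3F * q 3F)
            ∎)
      where
      open ≤-Reasoning poset
      factor : ∀ c x y z w → c * x + c * y + c * z + c * w ≈ c * (x + y + z + w)
      factor = solve 5 (λ c x y z w → c :* x :+ c :* y :+ c :* z :+ c :* w
                                   := c :* (x :+ y :+ z :+ w)) refl

  last-≤ : ∀ (a : Vector Carrier 4) → a 1F ≤ a 0F → a 2F ≤ a 1F → a 3F ≤ a 2F →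
    ∀ i → a 3F ≤ a i
  last-≤ a a₁≤a₀ a₂≤a₁ a₃≤a₂ = λ where
    0F → ≤-trans a₃≤a₂ (≤-trans a₂≤a₁ a₁≤a₀)
    1F → ≤-trans a₃≤a₂ a₂≤a₁
    2F → a₃≤a₂
    3F → ≤-refl

  -- The smaller of `P` and `Q` serves as W, the larger as M. Then W (2 + M) = a₃ - (M - W), and
  -- `hδ` identifies M - W with |a₀ - a₁ - a₂|. So one sign condition is an equality, and the other
  -- follows from W ≤ M.
  optimal-product-≤ : ∀ {P Q} (a p q : Vector Carrier 4) → 0# ≤ P → 0# ≤ Q →
    (∀ i → 0# ≤ p i) → (∀ i → 0# ≤ q i) →
    (∀ i → p i + q i + p i * q i ≈ a i) →
    p 0F + p 1F + p 2F + p 3F ≈ q 0F + q 1F + q 2F + q 3F →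
    a 1F ≤ a 0F → a 2F ≤ a 1F → a 3F ≤ a 2F →
    P + Q + P * Q ≈ a 3F →
    a 0F + Q ≈ a 1F + a 2F + P →
    P * Q ≤ p 0F * q 0F + p 1F * q 1F + p 2F * q 2F + p 3F * q 3F
  optimal-product-≤ {P} {Q} a p q 0≤P 0≤Q 0≤p 0≤q a≈ Σp≈Σq a₁≤a₀ a₂≤a₁ a₃≤a₂ A≈a₃ hδ
    with total P Q
  ... | inj₁ P≤Q = product-sum-≤ a p q 0≤Q 0≤p 0≤q a≈ A≤a Σp≈Σq a₂≤a₁ a₃≤a₂
    (linear-≤ (+-mono-≤ (≤-reflexive (sym hδ)) (≤-reflexive A≈a₃))
      (solve 6 (λ P Q a₀ a₁ a₂ a₃ →
           P :+ P :+ P :* Q :+ (a₁ :+ a₂) :+ (a₀ :+ Q :+ a₃)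
        := a₀ :+ a₃ :+ (a₁ :+ a₂ :+ P :+ (P :+ Q :+ P :* Q)))
        refl P Q (a 0F) (a 1F) (a 2F) (a 3F)))
    (linear-≤ (+-mono-≤ (+-mono-≤ (≤-reflexive hδ) (≤-reflexive A≈a₃)) (+-mono-≤ P≤Q P≤Q))
      (solve 6 (λ P Q a₀ a₁ a₂ a₃ →
           P :+ P :+ P :* Q :+ a₀ :+ (a₁ :+ a₂ :+ P :+ a₃ :+ (Q :+ Q))
        := a₁ :+ a₂ :+ a₃ :+ (a₀ :+ Q :+ (P :+ Q :+ P :* Q) :+ (P :+ P)))
        refl P Q (a 0F) (a 1F) (a 2F) (a 3F)))
    where
    A≤a : ∀ i → P + Q + P * Q ≤ a i
    A≤a i = ≤-respˡ-≈ (sym A≈a₃) (last-≤ a a₁≤a₀ a₂≤a₁ a₃≤a₂ i)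
  ... | inj₂ Q≤P = ≤-respˡ-≈ (*-comm Q P) (product-sum-≤ a p q 0≤P 0≤p 0≤q a≈ A≤a Σp≈Σq a₂≤a₁ a₃≤a₂
    (linear-≤ (+-mono-≤ (+-mono-≤ (≤-reflexive (sym hδ)) (≤-reflexive A≈a₃)) (+-mono-≤ Q≤P Q≤P))
      (solve 6 (λ P Q a₀ a₁ a₂ a₃ →
           Q :+ Q :+ Q :* P :+ (a₁ :+ a₂) :+ (a₀ :+ Q :+ a₃ :+ (P :+ P))
        := a₀ :+ a₃ :+ (a₁ :+ a₂ :+ P :+ (P :+ Q :+ P :* Q) :+ (Q :+ Q)))
        refl P Q (a 0F) (a 1F) (a 2F) (a 3F)))
    (linear-≤ (+-mono-≤ (≤-reflexive hδ) (≤-reflexive A≈a₃))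
      (solve 6 (λ P Q a₀ a₁ a₂ a₃ →
           Q :+ Q :+ Q :* P :+ a₀ :+ (a₁ :+ a₂ :+ P :+ a₃)
        := a₁ :+ a₂ :+ a₃ :+ (a₀ :+ Q :+ (P :+ Q :+ P :* Q)))
        refl P Q (a 0F) (a 1F) (a 2F) (a 3F))))
    where
    A≤a : ∀ i → Q + P + Q * P ≤ a i
    A≤a i = ≤-respˡ-≈ (trans (sym A≈a₃) (swap-sum P Q)) (last-≤ a a₁≤a₀ a₂≤a₁ a₃≤a₂ i)

  -- The numbers `P` and `Q` from the square root.

  -- With s the root, (s + δ) / 2 and (s - δ) / 2 have difference δ and product `r`. The hypotheses
  -- amount to (2 + δ)² ≤ s² and (2 - δ)² ≤ s², which make both halves at least 1. The witness `h`
  -- is (s - δ) / 2 - 1.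
  sqrt-split : ∀ {r δ} → δ + 1# ≤ r → 1# ≤ r + δ →
    ∃₂ λ P Q → 0# ≤ P × 0# ≤ Q × P ≈ Q + δ × (1# + P) * (1# + Q) ≈ r
             × √ (fromℕ 4 * r + δ * δ) ≈ (1# + P) + (1# + Q)
  sqrt-split {r} {δ} δ+1≤r 1≤r+δ =
    h + δ , h , 0≤P , 0≤h , refl , [1+P][1+Q]≈r , s≈
    where
    2# X s z d h : Carrier
    2# = 1# + 1#
    X = fromℕ 4 * r + δ * δ
    s = √ X
    z = 2# - δ
    [2+δ]²≤X : (2# + δ) * (2# + δ) ≤ X
    [2+δ]²≤X = linear-≤ (*-monoˡ-≤ (fromℕ-nonneg 4) δ+1≤r)
      -- `four` copies the unfolding of `fromℕ 4`, including its final `0#`.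
      (solve 2 (λ r δ →
           let four = con 1 :+ (con 1 :+ (con 1 :+ (con 1 :+ con 0))) in
           (con 2 :+ δ) :* (con 2 :+ δ) :+ four :* r
        := four :* r :+ δ :* δ :+ four :* (δ :+ con 1)) refl r δ)
    z+δ≈2 : z + δ ≈ 2#
    z+δ≈2 = x-y+y≈x 2# δ
    z²≤X : z * z ≤ X
    -- To keep the identity free of subtraction, `z` is an atom, and `z + δ ≈ 2#` is supplied
    -- multiplied by `z`, by `δ` and by 2.
    z²≤X = linear-≤
      (+-mono-≤ (*-monoˡ-≤ (fromℕ-nonneg 4) 1≤r+δ)
        (+-mono-≤ (≤-reflexive (*-congʳ {z} z+δ≈2))
          (+-mono-≤ (≤-reflexive (*-congʳ {δ} (sym z+δ≈2)))
                    (≤-reflexive (+-cong z+δ≈2 z+δ≈2)))))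
      (solve 3 (λ r δ z →
           let four = con 1 :+ (con 1 :+ (con 1 :+ (con 1 :+ con 0))) in
           z :* z :+ (four :* (r :+ δ) :+ (con 2 :* z :+ ((z :+ δ) :* δ :+ (con 2 :+ con 2))))
        := four :* r :+ δ :* δ
             :+ (four :* con 1 :+ ((z :+ δ) :* z :+ (con 2 :* δ :+ (z :+ δ :+ (z :+ δ))))))
        refl r δ z)
    s²≈X : s * s ≈ X
    s²≈X = √-square (≤-trans (square-nonneg (2# + δ)) [2+δ]²≤X)
    root-bound : ∀ {y} → y * y ≤ X → y ≤ s
    root-bound y²≤X = square-cancel-≤ (√-nonneg X) (≤-respʳ-≈ (sym s²≈X) y²≤X)
    gap : ∃ λ d → 0# ≤ d × 2# + δ + d ≈ s
    gap = difference (root-bound [2+δ]²≤X)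
    d = proj₁ gap
    h = 2# ⁻¹ * d
    0≤h : 0# ≤ h
    0≤h = *-nonneg (⁻¹-nonneg (+-nonneg 0≤1 0≤1) 2≉0) (proj₁ (proj₂ gap))
    h+h≈d : h + h ≈ d
    h+h≈d = trans (solve 2 (λ i d → i :* d :+ i :* d := i :* (con 2 :* d)) refl (2# ⁻¹) d)
      (⁻¹-*-cancelˡ d 2≉0)
    2+δ+2h≈s : 2# + δ + (h + h) ≈ s
    2+δ+2h≈s = trans (+-congˡ h+h≈d) (proj₂ (proj₂ gap))
    0≤P : 0# ≤ h + δ
    -- Twice `h + δ` equals s - z.
    0≤P = double-cancel-nonneg (linear-≤
      (+-mono-≤ (root-bound z²≤X) (≤-reflexive (+-cong (sym 2+δ+2h≈s) (sym z+δ≈2))))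
      (solve 4 (λ δ h s z → con 0 :+ (s :+ (con 2 :+ δ :+ (h :+ h) :+ (z :+ δ)))
                         := h :+ δ :+ (h :+ δ) :+ (z :+ (s :+ con 2))) refl δ h s z))
    s≈ : s ≈ (1# + (h + δ)) + (1# + h)
    s≈ = trans (sym 2+δ+2h≈s)
      (solve 2 (λ δ h → con 2 :+ δ :+ (h :+ h) := con 1 :+ (h :+ δ) :+ (con 1 :+ h)) refl δ h)
    [1+P][1+Q]≈r : (1# + (h + δ)) * (1# + h) ≈ r
    -- The square of the sum of the halves is 4 r + δ², and the square of their difference is δ²;
    -- hence four times their product is 4 r.
    [1+P][1+Q]≈r = double-cancel-≈ (double-cancel-≈ (linear-≈
      (trans (sym (*-cong s≈ s≈)) s²≈X)
      (solve 3 (λ r δ h →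
           let four = con 1 :+ (con 1 :+ (con 1 :+ (con 1 :+ con 0)))
               P = h :+ δ
               g = (con 1 :+ P) :* (con 1 :+ h)
               w = con 1 :+ P :+ (con 1 :+ h) in
           g :+ g :+ (g :+ g) :+ (four :* r :+ δ :* δ)
        := r :+ r :+ (r :+ r) :+ w :* w) refl r δ h)))

  -- Price quotients and means of four terms.

  1≤x/y : ∀ {x y} → 0# < y → y ≤ x → 1# ≤ x / y
  1≤x/y {x} {y} (0≤y , 0≉y) y≤x = ≤-respˡ-≈ (⁻¹-inverseʳ y≉0)
    (≤-respˡ-≈ (*-comm _ _) (≤-respʳ-≈ (*-comm _ _) (*-monoˡ-≤ (⁻¹-nonneg 0≤y y≉0) y≤x)))
    where
    y≉0 : ¬ (y ≈ 0#)
    y≉0 y≈0 = 0≉y (sym y≈0)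

  <-≤⇒≉0 : ∀ {x y} → 0# < y → y ≤ x → ¬ (x ≈ 0#)
  <-≤⇒≉0 (0≤y , 0≉y) y≤x x≈0 = 0≉y (antisym 0≤y (≤-respʳ-≈ x≈0 y≤x))

  /-chain : ∀ {x} m M → ¬ (x ≈ 0#) → (x / m) * (M / x) ≈ M / m
  /-chain {x} m M x≉0 = trans
    (solve 4 (λ x i M j → x :* i :* (M :* j) := j :* (x :* (M :* i))) refl x (m ⁻¹) M (x ⁻¹))
    (⁻¹-*-cancelˡ _ x≉0)

  sum₄ : Vector Carrier 4 → Carrier
  sum₄ f = f 0F + f 1F + f 2F + f 3F

  sum₄-cong : ∀ {f g} → (∀ i → f i ≈ g i) → sum₄ f ≈ sum₄ g
  sum₄-cong f≈g = +-cong (+-cong (+-cong (f≈g 0F) (f≈g 1F)) (f≈g 2F)) (f≈g 3F)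

  sum≈sum₄ : ∀ f → sum f ≈ sum₄ f
  sum≈sum₄ f = solve 4 (λ x y z w → x :+ (y :+ (z :+ (w :+ con 0))) := x :+ y :+ z :+ w) refl
    (f 0F) (f 1F) (f 2F) (f 3F)

  fromℕ-suc≉0 : ∀ n → ¬ (fromℕ (suc n) ≈ 0#)
  fromℕ-suc≉0 n = 1+x≉0 (fromℕ-nonneg n)

  fromℕ*1/ : ∀ n → fromℕ (suc n) * (1# / fromℕ (suc n)) ≈ 1#
  fromℕ*1/ n = trans (*-congˡ (*-identityˡ _)) (⁻¹-inverseʳ (fromℕ-suc≉0 n))

  1/fromℕ-nonneg : ∀ n → 0# ≤ 1# / fromℕ (suc n)
  1/fromℕ-nonneg n = *-nonneg 0≤1 (⁻¹-nonneg (fromℕ-nonneg (suc n)) (fromℕ-suc≉0 n))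

  mean-cancel : ∀ f g → mean {4} f ≈ mean g → sum₄ f ≈ sum₄ g
  mean-cancel f g mf≈mg = trans (sym (sum≈sum₄ f)) (trans (*-cancelˡ-≈ 1/4≉0 mf≈mg) (sum≈sum₄ g))
    where
    1/4≉0 : ¬ (1# / fromℕ 4 ≈ 0#)
    1/4≉0 e = 1≉0 (trans (sym (fromℕ*1/ 3)) (trans (*-congˡ e) (zeroʳ _)))

  -- Doubling the sum allows the constraint to replace one copy of Σ M / x by Σ x / m, which
  -- produces the factor 1/8 of the claimed value.
  mean≈eighth : ∀ f → mean f ≈ (1# / fromℕ 8) * (sum₄ f + sum₄ f)
  mean≈eighth f = trans (*-cong 1/4≈ (sum≈sum₄ f))
    (solve 2 (λ c x → (c :+ c) :* x := c :* (x :+ x)) refl (1# / fromℕ 8) (sum₄ f))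
    where
    1/4≈ : 1# / fromℕ 4 ≈ 1# / fromℕ 8 + 1# / fromℕ 8
    1/4≈ = *-cancelˡ-≈ (fromℕ-suc≉0 3) (trans (fromℕ*1/ 3) (trans (sym (fromℕ*1/ 7))
      (solve 1 (λ c →
           let four = con 1 :+ (con 1 :+ (con 1 :+ (con 1 :+ con 0)))
               eight = con 1 :+ (con 1 :+ (con 1 :+ (con 1 :+ four))) in
           eight :* c := four :* (c :+ c)) refl (1# / fromℕ 8))))

  -- The claimed value as an attained upper bound.

  module _ (m M : Vector Carrier 4) (0<m : ∀ i → 0# < m i) (m≤M : ∀ i → m i ≤ M i)
           {P Q : Carrier} (0≤P : 0# ≤ P) (0≤Q : 0# ≤ Q) where
    open TimeSeriesSearch ℝ

    private
      r a : Vector Carrier 4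
      r = fluctuationRatio m M
      a i = r i - 1#

      -- Eight times the claimed ratio, with the square root replaced by the sum of its halves.
      bound : Carrier
      bound = (1# + P) + (1# + Q) + (r 0F + 1#) + (r 1F + 1#) + (r 2F + 1#)

      r≈a+1 : ∀ i → r i ≈ a i + 1#
      r≈a+1 i = sym (x-y+y≈x (r i) 1#)

    p+q+pq≈a : ∀ i {p q} → (1# + p) * (1# + q) ≈ r i → p + q + p * q ≈ a i
    p+q+pq≈a i {p} {q} h = linear-≈ (trans h (r≈a+1 i))
      (solve 3 (λ p q a → p :+ q :+ p :* q :+ (a :+ con 1)
                       := a :+ (con 1 :+ p) :* (con 1 :+ q)) refl p q (a i))

    -- This identity turns an upper bound for Σ (u + v) into a lower bound for Σ p q, because each u
    -- v is fixed.
    u+v+pq≈r+1 : ∀ {p q u v ρ} → 1# + p ≈ u → 1# + q ≈ v → u * v ≈ ρ → u + v + p * q ≈ ρ + 1#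
    u+v+pq≈r+1 {p} {q} {u} {v} {ρ} hu hv uv≈ρ = trans (+-congʳ (sym (+-cong hu hv)))
      (trans (solve 2 (λ p q → con 1 :+ p :+ (con 1 :+ q) :+ p :* q
                            := (con 1 :+ p) :* (con 1 :+ q) :+ con 1) refl p q)
        (+-congʳ (trans (*-cong hu hv) uv≈ρ)))

    module _ ([1+P][1+Q]≈r₃ : (1# + P) * (1# + Q) ≈ r 3F)
             (a₀+Q≈a₁+a₂+P : a 0F + Q ≈ a 1F + a 2F + P) where

      value-≤ : r 1F ≤ r 0F → r 2F ≤ r 1F → r 3F ≤ r 2F → ∀ x → 𝒮 m M x →
        mean (λ i → M i / x i) ≤ (1# / fromℕ 8) * bound
      value-≤ r₁≤r₀ r₂≤r₁ r₃≤r₂ x (m≤x≤M , means) = ≤-respˡ-≈ (sym (mean≈eighth v))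
        (*-monoˡ-≤ (1/fromℕ-nonneg 7) (≤-respˡ-≈ (+-congʳ Σu≈Σv) Σu+Σv≤bound))
        where
        u v p q : Vector Carrier 4
        u i = x i / m i
        v i = M i / x i
        Σu≈Σv : sum₄ u ≈ sum₄ v
        Σu≈Σv = mean-cancel u v means
        x≉0 : ∀ i → ¬ (x i ≈ 0#)
        x≉0 i = <-≤⇒≉0 (0<m i) (proj₁ (m≤x≤M i))
        0<x : ∀ i → 0# < x i
        0<x i = ≤-trans (proj₁ (0<m i)) (proj₁ (m≤x≤M i)) , λ e → x≉0 i (sym e)
        u-gap : ∀ i → ∃ λ p → 0# ≤ p × 1# + p ≈ u i
        u-gap i = difference (1≤x/y (0<m i) (proj₁ (m≤x≤M i)))
        v-gap : ∀ i → ∃ λ q → 0# ≤ q × 1# + q ≈ v i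
        v-gap i = difference (1≤x/y (0<x i) (proj₂ (m≤x≤M i)))
        p i = proj₁ (u-gap i)
        q i = proj₁ (v-gap i)
        1+p≈u : ∀ i → 1# + p i ≈ u i
        1+p≈u i = proj₂ (proj₂ (u-gap i))
        1+q≈v : ∀ i → 1# + q i ≈ v i
        1+q≈v i = proj₂ (proj₂ (v-gap i))
        uv≈r : ∀ i → u i * v i ≈ r i
        uv≈r i = /-chain (m i) (M i) (x≉0 i)
        sum₄-1+ : ∀ f → sum₄ (λ i → 1# + f i) ≈ sum₄ f + (1# + 1# + 1# + 1#)
        sum₄-1+ f = solve 4 (λ x y z w →
             con 1 :+ x :+ (con 1 :+ y) :+ (con 1 :+ z) :+ (con 1 :+ w)
          := x :+ y :+ z :+ w :+ (con 1 :+ con 1 :+ con 1 :+ con 1)) refl (f 0F) (f 1F) (f 2F) (f 3F)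
        Σp≈Σq : sum₄ p ≈ sum₄ q
        Σp≈Σq = linear-≈
          (trans (sym (sum₄-1+ p)) (trans (sum₄-cong 1+p≈u) (trans Σu≈Σv
            (trans (sym (sum₄-cong 1+q≈v)) (sum₄-1+ q)))))
          (solve 2 (λ x y → x :+ (y :+ (con 1 :+ con 1 :+ con 1 :+ con 1))
                         := y :+ (x :+ (con 1 :+ con 1 :+ con 1 :+ con 1))) refl (sum₄ p) (sum₄ q))
        PQ≤Σpq : P * Q ≤ sum₄ (λ i → p i * q i)
        PQ≤Σpq = optimal-product-≤ a p q 0≤P 0≤Q
          (λ i → proj₁ (proj₂ (u-gap i))) (λ i → proj₁ (proj₂ (v-gap i)))
          (λ i → p+q+pq≈a i (trans (*-cong (1+p≈u i) (1+q≈v i)) (uv≈r i)))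
          Σp≈Σq (+-monoˡ-≤ _ r₁≤r₀) (+-monoˡ-≤ _ r₂≤r₁) (+-monoˡ-≤ _ r₃≤r₂)
          (p+q+pq≈a 3F [1+P][1+Q]≈r₃) a₀+Q≈a₁+a₂+P
        u+v+pq≤r+1 : ∀ i → u i + v i + p i * q i ≤ r i + 1#
        u+v+pq≤r+1 i = ≤-reflexive (u+v+pq≈r+1 (1+p≈u i) (1+q≈v i) (uv≈r i))
        Σu+Σv≤bound : sum₄ u + sum₄ v ≤ bound
        -- The fourth `r 3F + 1#` exceeds (1 + P) + (1 + Q) by exactly `P * Q`, and `PQ≤Σpq` pays
        -- for this excess.
        Σu+Σv≤bound = linear-≤
          (+-mono-≤
            (+-mono-≤ (+-mono-≤ (u+v+pq≤r+1 0F) (u+v+pq≤r+1 1F))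
                      (+-mono-≤ (u+v+pq≤r+1 2F) (u+v+pq≤r+1 3F)))
            (+-mono-≤ (≤-reflexive (sym (u+v+pq≈r+1 refl refl [1+P][1+Q]≈r₃))) PQ≤Σpq))
          (solve 18 (λ u₀ u₁ u₂ u₃ v₀ v₁ v₂ v₃ d₀ d₁ d₂ d₃ r₀ r₁ r₂ r₃ s D →
               u₀ :+ u₁ :+ u₂ :+ u₃ :+ (v₀ :+ v₁ :+ v₂ :+ v₃)
                 :+ (r₀ :+ con 1 :+ (r₁ :+ con 1) :+ (r₂ :+ con 1 :+ (r₃ :+ con 1))
                     :+ (s :+ D :+ (d₀ :+ d₁ :+ d₂ :+ d₃)))
            := s :+ (r₀ :+ con 1) :+ (r₁ :+ con 1) :+ (r₂ :+ con 1)
                 :+ (u₀ :+ v₀ :+ d₀ :+ (u₁ :+ v₁ :+ d₁) :+ (u₂ :+ v₂ :+ d₂ :+ (u₃ :+ v₃ :+ d₃))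
                     :+ (r₃ :+ con 1 :+ D)))
            refl (u 0F) (u 1F) (u 2F) (u 3F) (v 0F) (v 1F) (v 2F) (v 3F)
            (p 0F * q 0F) (p 1F * q 1F) (p 2F * q 2F) (p 3F * q 3F)
            (r 0F) (r 1F) (r 2F) (r 3F) ((1# + P) + (1# + Q)) (P * Q))

      -- In the first three coordinates p or q vanishes, and the last one has (p , q) = (P , Q), so
      -- Σ p q is `P * Q`. The constraint Σ p = Σ q becomes `a₀+Q≈a₁+a₂+P`.
      optimum : Vector Carrier 4
      optimum 0F = m 0F
      optimum 1F = M 1F
      optimum 2F = M 2F
      optimum 3F = m 3F * (1# + P)

      optimum-value : Values m M ((1# / fromℕ 8) * bound)
      optimum-value = optimum , ((λ i → m≤o i , o≤M i) , means)
        , sym (trans (mean≈eighth v) (*-congˡ 2Σv≈bound))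
        where
        u v : Vector Carrier 4
        u i = optimum i / m i
        v i = M i / optimum i
        m≉0 : ∀ i → ¬ (m i ≈ 0#)
        m≉0 i = <-≤⇒≉0 (0<m i) ≤-refl
        M≉0 : ∀ i → ¬ (M i ≈ 0#)
        M≉0 i = <-≤⇒≉0 (0<m i) (m≤M i)
        m≤o : ∀ i → m i ≤ optimum i
        m≤o 0F = ≤-refl
        m≤o 1F = m≤M 1F
        m≤o 2F = m≤M 2F
        m≤o 3F = ≤-respˡ-≈ (*-identityʳ _) (*-monoˡ-≤ (proj₁ (0<m 3F)) (x≤x+y 0≤P))
        m*r≈M : m 3F * r 3F ≈ M 3F
        m*r≈M = trans (solve 3 (λ m M i → m :* (M :* i) := i :* (m :* M)) refl (m 3F) (M 3F) (m 3F ⁻¹))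
          (⁻¹-*-cancelˡ _ (m≉0 3F))
        o₃[1+Q]≈M₃ : optimum 3F * (1# + Q) ≈ M 3F
        o₃[1+Q]≈M₃ = trans (*-assoc _ _ _) (trans (*-congˡ [1+P][1+Q]≈r₃) m*r≈M)
        o≤M : ∀ i → optimum i ≤ M i
        o≤M 0F = m≤M 0F
        o≤M 1F = ≤-refl
        o≤M 2F = ≤-refl
        o≤M 3F = ≤-respˡ-≈ (*-identityʳ _) (≤-respʳ-≈ o₃[1+Q]≈M₃
          (*-monoˡ-≤ (≤-trans (proj₁ (0<m 3F)) (m≤o 3F)) (x≤x+y 0≤Q)))
        u₃≈1+P : u 3F ≈ 1# + P
        u₃≈1+P = trans (*-comm _ _) (⁻¹-*-cancelˡ _ (m≉0 3F))
        v₃≈1+Q : v 3F ≈ 1# + Q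
        v₃≈1+Q = trans (*-congʳ (sym o₃[1+Q]≈M₃)) (trans (*-comm _ _)
          (⁻¹-*-cancelˡ _ (<-≤⇒≉0 (0<m 3F) (m≤o 3F))))
        Σu≈ : sum₄ u ≈ 1# + r 1F + r 2F + (1# + P)
        Σu≈ = +-cong (+-congʳ (+-congʳ (⁻¹-inverseʳ (m≉0 0F)))) u₃≈1+P
        Σv≈ : sum₄ v ≈ r 0F + 1# + 1# + (1# + Q)
        Σv≈ = +-cong (+-cong (+-congˡ (⁻¹-inverseʳ (M≉0 1F))) (⁻¹-inverseʳ (M≉0 2F))) v₃≈1+Q
        Σu≈Σv : sum₄ u ≈ sum₄ v
        Σu≈Σv = trans Σu≈ (trans (linear-≈
          (+-cong (sym a₀+Q≈a₁+a₂+P) (+-cong (sym (r≈a+1 0F)) (+-cong (r≈a+1 1F) (r≈a+1 2F))))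
          (solve 8 (λ P Q a₀ a₁ a₂ r₀ r₁ r₂ →
               con 1 :+ r₁ :+ r₂ :+ (con 1 :+ P)
                 :+ (a₀ :+ Q :+ (r₀ :+ (a₁ :+ con 1 :+ (a₂ :+ con 1))))
            := r₀ :+ con 1 :+ con 1 :+ (con 1 :+ Q)
                 :+ (a₁ :+ a₂ :+ P :+ (a₀ :+ con 1 :+ (r₁ :+ r₂))))
            refl P Q (a 0F) (a 1F) (a 2F) (r 0F) (r 1F) (r 2F))) (sym Σv≈))
        means : mean u ≈ mean v
        means = *-congˡ (trans (sum≈sum₄ u) (trans Σu≈Σv (sym (sum≈sum₄ v))))
        2Σv≈bound : sum₄ v + sum₄ v ≈ bound
        2Σv≈bound = trans (+-congʳ (sym Σu≈Σv)) (trans (+-cong Σu≈ Σv≈)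
          (solve 5 (λ P Q r₀ r₁ r₂ →
               con 1 :+ r₁ :+ r₂ :+ (con 1 :+ P) :+ (r₀ :+ con 1 :+ con 1 :+ (con 1 :+ Q))
            := con 1 :+ P :+ (con 1 :+ Q) :+ (r₀ :+ con 1) :+ (r₁ :+ con 1) :+ (r₂ :+ con 1))
            refl P Q (r 0F) (r 1F) (r 2F)))

-- From the two hypotheses on r₁ to the supremum.

theorem6p2 :
    ∀ {ℓ} (ℝ : CompleteOrderedField ℓ) →
    let open CompleteOrderedField ℝ
        open TimeSeriesSearch ℝ
    in
    (m M : Vector Carrier 4) →
    (∀ i → 0# < m i) →
    (∀ i → m i ≤ M i) →
    let r₁ = fluctuationRatio m M 0F
        r₂ = fluctuationRatio m M 1F
        r₃ = fluctuationRatio m M 2F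
        r₄ = fluctuationRatio m M 3F
        δ  = ((r₁ - 1#) - (r₂ - 1#)) - (r₃ - 1#)
    in
    r₂ ≤ r₁ →
    r₃ ≤ r₂ →
    r₄ ≤ r₃ →
    1# ≤ r₄ →
    ((r₂ - 1#) + (r₃ - 1#)) - (r₄ - 1#) ≤ r₁ - 1# →
    r₁ - 1# < ((r₂ - 1#) + (r₃ - 1#)) + (r₄ - 1#) →
    IsMeanComponentCompetitiveRatio m M
      ((1# / fromℕ 8) *
        (√ (fromℕ 4 * r₄ + δ * δ) + (r₁ + 1#) + (r₂ + 1#) + (r₃ + 1#)))
theorem6p2 ℝ m M 0<m m≤M r₂≤r₁ r₃≤r₂ r₄≤r₃ _ lower (upper , _) =
  let P , Q , 0≤P , 0≤Q , P≈Q+δ , [1+P][1+Q]≈r₄ , √≈ = sqrt-split ℝ δ+1≤r₄ 1≤r₄+δ in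
  conclude 0≤P 0≤Q P≈Q+δ [1+P][1+Q]≈r₄ √≈
  where
  open CompleteOrderedField ℝ
  open TimeSeriesSearch ℝ
  open OrderedFieldProperties ℝ
  r a : Vector Carrier 4
  r = fluctuationRatio m M
  a i = r i - 1#
  δ c s z : Carrier
  δ = a 0F - a 1F - a 2F
  c = a 1F + a 2F - a 3F
  s = √ (fromℕ 4 * r 3F + δ * δ)
  z = (1# / fromℕ 8) * (s + (r 0F + 1#) + (r 1F + 1#) + (r 2F + 1#))
  δ+a₃+a₂≈a₁ : δ + a 2F + a 1F ≈ a 0F
  δ+a₃+a₂≈a₁ = trans (+-congʳ (x-y+y≈x _ _)) (x-y+y≈x _ _)
  a₄+1≈r₄ : a 3F + 1# ≈ r 3F
  a₄+1≈r₄ = x-y+y≈x (r 3F) 1#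
  -- `upper` and `lower` say that δ lies between - a₄ and a₄; adding 1 gives the two conditions of
  -- `sqrt-split`.
  δ+1≤r₄ : δ + 1# ≤ r 3F
  δ+1≤r₄ = linear-≤ (+-mono-≤ upper (≤-reflexive (+-cong δ+a₃+a₂≈a₁ a₄+1≈r₄)))
    (solve 6 (λ a₁ a₂ a₃ a₄ r₄ δ → δ :+ con 1 :+ (a₂ :+ a₃ :+ a₄ :+ (a₁ :+ r₄))
                                := r₄ :+ (a₁ :+ (δ :+ a₃ :+ a₂ :+ (a₄ :+ con 1))))
      refl (a 0F) (a 1F) (a 2F) (a 3F) (r 3F) δ)
  1≤r₄+δ : 1# ≤ r 3F + δ
  1≤r₄+δ = linear-≤
    (+-mono-≤ lower (≤-reflexive
      (+-cong (sym (x-y+y≈x (a 1F + a 2F) (a 3F))) (+-cong (sym δ+a₃+a₂≈a₁) a₄+1≈r₄))))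
    (solve 7 (λ a₁ a₂ a₃ a₄ r₄ δ c →
         con 1 :+ (a₁ :+ (c :+ a₄ :+ (δ :+ a₃ :+ a₂ :+ r₄)))
      := r₄ :+ δ :+ (c :+ (a₂ :+ a₃ :+ (a₁ :+ (a₄ :+ con 1)))))
      refl (a 0F) (a 1F) (a 2F) (a 3F) (r 3F) δ c)
  conclude : ∀ {P Q} → 0# ≤ P → 0# ≤ Q → P ≈ Q + δ → (1# + P) * (1# + Q) ≈ r 3F →
    s ≈ (1# + P) + (1# + Q) → IsMeanComponentCompetitiveRatio m M z
  conclude {P} {Q} 0≤P 0≤Q P≈Q+δ [1+P][1+Q]≈r₄ s≈ = record
    { isUpperBound = λ { v (x , x∈𝒮 , v≈mean) → ≤-respˡ-≈ (sym v≈mean) (≤-respʳ-≈ (sym z≈)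
        (value-≤ ℝ m M 0<m m≤M 0≤P 0≤Q [1+P][1+Q]≈r₄ a₁+Q≈a₂+a₃+P r₂≤r₁ r₃≤r₂ r₄≤r₃ x x∈𝒮)) }
    -- The value is attained, so every upper bound dominates it.
    ; isLeast = λ b b-bound → ≤-respˡ-≈ (sym z≈)
        (b-bound _ (optimum-value ℝ m M 0<m m≤M 0≤P 0≤Q [1+P][1+Q]≈r₄ a₁+Q≈a₂+a₃+P))
    }
    where
    z≈ : z ≈ (1# / fromℕ 8) *
             ((1# + P) + (1# + Q) + (r 0F + 1#) + (r 1F + 1#) + (r 2F + 1#))
    z≈ = *-congˡ (+-congʳ (+-congʳ (+-congʳ s≈)))
    a₁+Q≈a₂+a₃+P : a 0F + Q ≈ a 1F + a 2F + P
    a₁+Q≈a₂+a₃+P = linear-≈ (+-cong (sym δ+a₃+a₂≈a₁) (sym P≈Q+δ))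
      (solve 6 (λ P Q a₁ a₂ a₃ δ → a₁ :+ Q :+ (δ :+ a₃ :+ a₂ :+ P)
                                := a₂ :+ a₃ :+ P :+ (a₁ :+ (Q :+ δ))) refl P Q (a 0F) (a 1F) (a 2F) δ)
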